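{- Let $k$ be an even positive integer and let $Q_k$ be the para-chain square cactus of length $k$. Then: \begin{enumerate} \item[(i)] $af(Q_k^2) = 10k - 4$, and for every even integer $m \geq 4$, $$af(Q_k^m) = af(Q_k^{m-1}) + 5\left(k - \frac{m}{2}\right) + 1;$$ \item[(ii)] for every odd integer $m \geq 3$, $$af(Q_k^m) = af(Q_k^{m-1}) + 4\left(k - \left\lfloor \frac{m}{2} \right\rfloor\right).$$ \end{enumerate}
   Context: All graphs are simple. A perfect matching of a graph $G$ is a set of pairwise disjoint edges covering all vertices of $G$. For $S \subseteq E(G)$, $S$ is an anti-forcing set if the graph $G - S$ obtained by deleting the edges of $S$ has a unique perfect matching. The anti-forcing number $af(G)$ is the minimum cardinality of an anti-forcing set of $G$; by convention $af(G) = |E(G)|$ when $G$ has no perfect matching. For $m \in \mathbb{N}$, the $m$-th power $G^m$ is the graph on $V(G)$ in which two distinct vertices are adjacent iff their distance in $G$ is at most $m$. A chain square cactus of length $k$ is a connected graph whose blocks are exactly $k$ cycles of length $4$ (squares), such that each square contains at most two cut-vertices and each cut-vertex lies in exactly two squares. It is a para-chain square cactus if in every square containing two cut-vertices these two cut-vertices are non-adjacent (opposite in the square); $Q_k$ denotes this graph (unique up to isomorphism). It has $3k+1$ vertices and $4k$ edges.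
   Formalization: The recurrence of (i) holds for even m with 4 ≤ m ≤ 2k only, and that of (ii) for odd m with 3 ≤ m ≤ 2k+1 only. The statement above fails without it. -}

module Defs where

open import Data.Nat using (ℕ; zero; suc; _+_; _*_; _≤_; _<_)
open import Data.Fin using (Fin; toℕ)
open import Data.Product using (Σ; _×_; ∃; _,_)
open import Data.Sum using (_⊎_)
open import Data.List using (List; length)
open import Data.List.Membership.Propositional using (_∈_; _∉_)
open import Data.List.Relation.Unary.All using (All)
open import Data.List.Relation.Unary.Unique.Propositional using (Unique)
open import Relation.Binary.PropositionalEquality using (_≡_; _≢_)
open import Relation.Nullary using (¬_)

-- Graphs on the vertex set Fin n, given by their adjacency relation.
-- (The graphs used below are simple: symmetric, irreflexive adjacency.)

Graph : ℕ → Set₁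
Graph n = Fin n → Fin n → Set

-- An edge {x,y} is recorded canonically as the ordered pair (x , y) with x < y.
IsEdge : ∀ {n} → Graph n → Fin n × Fin n → Set
IsEdge G (x , y) = (toℕ x < toℕ y) × G x y

EdgeCount : ∀ {n} → Graph n → ℕ → Set
EdgeCount {n} G e =
  Σ (List (Fin n × Fin n)) λ L →
    All (IsEdge G) L × Unique L
    × (∀ x y → IsEdge G (x , y) → (x , y) ∈ L)
    × length L ≡ e

-- A perfect matching is encoded by its partner map:
-- p x is the vertex matched with x; p is a fixed-point-free involution
-- and every x is adjacent to p x.  (Pairwise disjoint edges covering all
-- vertices correspond exactly to such maps.)

record PerfectMatching {n} (G : Graph n) : Set where
  field
    partner   : Fin n → Fin n
    adjacent  : ∀ x → G x (partner x)
    involutive : ∀ x → partner (partner x) ≡ x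
    no-fixed  : ∀ x → partner x ≢ x

open PerfectMatching public

HasPM : ∀ {n} → Graph n → Set
HasPM G = PerfectMatching G

UniquePM : ∀ {n} → Graph n → Set
UniquePM G =
  PerfectMatching G ×
  (∀ (M M' : PerfectMatching G) → ∀ x → partner M x ≡ partner M' x)

delete : ∀ {n} → Graph n → List (Fin n × Fin n) → Graph n
delete G S x y = G x y × (x , y) ∉ S × (y , x) ∉ S

IsAntiForcingSet : ∀ {n} → Graph n → List (Fin n × Fin n) → Set
IsAntiForcingSet G S = All (IsEdge G) S × Unique S × UniquePM (delete G S)

-- af(G) = a : a is the minimum cardinality of an anti-forcing set;
-- by convention af(G) = |E(G)| when G has no perfect matching.
AntiForcingNumber : ∀ {n} → Graph n → ℕ → Set
AntiForcingNumber {n} G a =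
  (HasPM G ×
    (Σ (List (Fin n × Fin n)) λ S → IsAntiForcingSet G S × length S ≡ a) ×
    (∀ S → IsAntiForcingSet G S → a ≤ length S))
  ⊎ (¬ HasPM G × EdgeCount G a)

data Walk {n} (G : Graph n) : ℕ → Fin n → Fin n → Set where
  here : ∀ {x} → Walk G 0 x x
  step : ∀ {l x y z} → G x y → Walk G l y z → Walk G (suc l) x z

power : ∀ {n} → Graph n → ℕ → Graph n
power G m x y = x ≢ y × Σ ℕ λ l → l ≤ m × Walk G l x y

-- Square i (i = 0 .. k-1) has vertices 3i, 3i+1, 3i+2, 3i+3 and edges
-- 3i–3i+1, 3i–3i+2, 3i+1–3i+3, 3i+2–3i+3; the cut-vertices 3i and 3i+3
-- are opposite in the square.

SquareEdge : ℕ → ℕ → ℕ → Set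
SquareEdge i x y =
    (x ≡ 3 * i × y ≡ 3 * i + 1)
  ⊎ (x ≡ 3 * i × y ≡ 3 * i + 2)
  ⊎ (x ≡ 3 * i + 1 × y ≡ 3 * i + 3)
  ⊎ (x ≡ 3 * i + 2 × y ≡ 3 * i + 3)

QAdj : ℕ → ℕ → ℕ → Set
QAdj k x y = Σ ℕ λ i → i < k × (SquareEdge i x y ⊎ SquareEdge i y x)

Q : (k : ℕ) → Graph (suc (3 * k))
Q k x y = QAdj k (toℕ x) (toℕ y)

module Submission where

-- For even k the cactus Q_k has 3k + 1 vertices, an odd number, while a perfect
-- matching forces an even number of vertices (its partner map p is an involution
-- exchanging {x : x < p x} and {x : p x < x}).  So no power of Q_k has a perfect
-- matching, and af(Q_k^m) = |E(Q_k^m)|.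
--
-- To count these edges, give each vertex its level, the distance from vertex 0:
-- the cut vertex 3i has level 2i, the other two vertices 3i+1, 3i+2 of square i
-- have level 2i+1.  An edge changes the level by at most one, and any a < b are
-- joined by a walk of length level b - level a, except the two middle vertices of
-- a square, which share a level and are at distance 2.  Hence for m ≥ 2 the edges
-- of Q_k^m are the pairs whose levels differ by at most m.  Counting pairs by their
-- level gap d gives k pairs for d = 0, 4(k - t) for d = 2t + 1 and
-- (k - t) + 4(k - t - 1) for d = 2t + 2; the recurrences add these counts.

open import Defs
open import Data.Bool.Base using (Bool; true; false; T)
open import Data.Bool.Properties using (T-≡)
open import Data.Empty using (⊥)
open import Data.Fin.Base using (Fin; zero; suc; toℕ)
open import Data.Fin.Permutation using (Permutation′; permutation)
open import Data.Fin.Properties using (toℕ-injective; toℕ-fromℕ<; toℕ<n)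
open import Data.List.Base using (List; []; _∷_; _++_; map; tabulate; filter; length)
open import Data.List.Membership.Propositional using (_∈_)
open import Data.List.Membership.Propositional.Properties
  using (∈-map⁺; ∈-map⁻; ∈-++⁺ˡ; ∈-++⁺ʳ; ∈-++⁻; ∈-tabulate⁺; ∈-tabulate⁻; ∈-filter⁺; ∈-filter⁻)
import Data.List.Relation.Unary.All as All
open import Data.List.Relation.Unary.AllPairs using ([])
open import Data.List.Relation.Unary.Unique.Propositional using (Unique)
import Data.List.Relation.Unary.Unique.Propositional.Properties as Unique
open import Data.Nat.Base
  using (ℕ; zero; suc; _+_; _*_; _∸_; _≤_; _<_; z≤n; s≤s; z<s; s<s; _≤′_; ≤′-refl; ≤′-step;
         _≤ᵇ_; _<ᵇ_; _≡ᵇ_; _%_; ⌊_/2⌋)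
open import Data.Nat.DivMod using (m*n%n≡0; [m+kn]%n≡m%n)
open import Data.Nat.Divisibility using (_∣_; divides; ∣1⇒≡1; ∣m+n∣m⇒∣n; ∣n⇒∣m*n; m%n≡0⇒n∣m)
open import Data.Nat.Properties
open import Data.Nat.Tactic.RingSolver using (solve-∀)
open import Data.Product using (Σ; ∃; _×_; _,_; proj₁; proj₂)
open import Data.Sum using (_⊎_; inj₁; inj₂)
open import Function using (_∘_; _⇔_; mk⇔; Equivalence)
open import Relation.Binary.PropositionalEquality
open import Relation.Nullary using (¬_; contradiction)
open import Relation.Nullary.Decidable using (T?)

open import Algebra.Properties.CommutativeMonoid.Sum +-0-commutativeMonoid
  using (sum-syntax; ∑-distrib-+; ∑-permute; sum-cong-≗)
open import Algebra.Properties.CommutativeSemigroup +-commutativeSemigroup using (interchange)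

cong₃ : ∀ {A B C D : Set} (f : A → B → C → D) {a a′ b b′ c c′} →
  a ≡ a′ → b ≡ b′ → c ≡ c′ → f a b c ≡ f a′ b′ c′
cong₃ f refl refl refl = refl

𝟙 : Bool → ℕ
𝟙 true  = 1
𝟙 false = 0

𝟙-<ᵇ-total : ∀ {a b} → a ≢ b → 𝟙 (a <ᵇ b) + 𝟙 (b <ᵇ a) ≡ 1
𝟙-<ᵇ-total {zero}  {zero}  a≢b = contradiction refl a≢b
𝟙-<ᵇ-total {zero}  {suc b} _   = refl
𝟙-<ᵇ-total {suc a} {zero}  _   = refl
𝟙-<ᵇ-total {suc a} {suc b} a≢b = 𝟙-<ᵇ-total (a≢b ∘ cong suc)

∑-const-1 : ∀ n → ∑[ _ < n ] 1 ≡ n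
∑-const-1 zero    = refl
∑-const-1 (suc n) = cong suc (∑-const-1 n)

perfectMatching⇒even : ∀ {n} {G : Graph n} → PerfectMatching G → 2 ∣ n
perfectMatching⇒even {n} M = divides S (begin
  n                           ≡⟨ ∑-const-1 n ⟨
  ∑[ x < n ] 1                ≡⟨ sum-cong-≗ up+down≡1 ⟨
  ∑[ x < n ] (up x + down x)  ≡⟨ ∑-distrib-+ up down ⟩
  S + ∑[ x < n ] down x       ≡⟨ cong (S +_) (∑-permute down π) ⟩
  S + ∑[ x < n ] down (p x)   ≡⟨ cong (S +_) (sum-cong-≗ down∘p≗up) ⟩
  S + S                       ≡⟨ cong (S +_) (+-identityʳ S) ⟨
  2 * S                       ≡⟨ *-comm 2 S ⟩
  S * 2                       ∎)
  where
  open ≡-Reasoning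
  p = partner M
  π : Permutation′ n
  π = permutation p p (involutive M) (involutive M)
  up down : Fin n → ℕ
  up   x = 𝟙 (toℕ x <ᵇ toℕ (p x))
  down x = 𝟙 (toℕ (p x) <ᵇ toℕ x)
  S : ℕ
  S = ∑[ x < n ] up x
  up+down≡1 : ∀ x → up x + down x ≡ 1
  up+down≡1 x = 𝟙-<ᵇ-total (λ x≡px → no-fixed M x (sym (toℕ-injective x≡px)))
  down∘p≗up : ∀ x → down (p x) ≡ up x
  down∘p≗up x rewrite involutive M x = refl

countBelow : ℕ → (ℕ → Bool) → ℕ
countBelow zero    f = 0
countBelow (suc n) f = 𝟙 (f 0) + countBelow n (f ∘ suc)

countPairs : ℕ → (ℕ → ℕ → Bool) → ℕ
countPairs zero    g = 0
countPairs (suc n) g = countBelow n (g 0 ∘ suc) + countPairs n (λ a b → g (suc a) (suc b))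

countBelow-false : ∀ n → countBelow n (λ _ → false) ≡ 0
countBelow-false zero    = refl
countBelow-false (suc n) = countBelow-false n

countBelow-+ : ∀ n {f f₁ f₂ : ℕ → Bool} → (∀ b → 𝟙 (f b) ≡ 𝟙 (f₁ b) + 𝟙 (f₂ b)) →
  countBelow n f ≡ countBelow n f₁ + countBelow n f₂
countBelow-+ zero    split = refl
countBelow-+ (suc n) {f} {f₁} {f₂} split = begin
  𝟙 (f 0) + countBelow n (f ∘ suc)
    ≡⟨ cong₂ _+_ (split 0) (countBelow-+ n (split ∘ suc)) ⟩
  (𝟙 (f₁ 0) + 𝟙 (f₂ 0)) + (countBelow n (f₁ ∘ suc) + countBelow n (f₂ ∘ suc))
    ≡⟨ interchange (𝟙 (f₁ 0)) _ _ _ ⟩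
  countBelow (suc n) f₁ + countBelow (suc n) f₂ ∎
  where open ≡-Reasoning

countBelow-cong : ∀ n {f f′ : ℕ → Bool} → f ≗ f′ → countBelow n f ≡ countBelow n f′
countBelow-cong zero    f≗f′ = refl
countBelow-cong (suc n) f≗f′ = cong₂ _+_ (cong 𝟙 (f≗f′ 0)) (countBelow-cong n (f≗f′ ∘ suc))

countPairs-+ : ∀ n {g g₁ g₂ : ℕ → ℕ → Bool} → (∀ a b → 𝟙 (g a b) ≡ 𝟙 (g₁ a b) + 𝟙 (g₂ a b)) →
  countPairs n g ≡ countPairs n g₁ + countPairs n g₂
countPairs-+ zero    split = refl
countPairs-+ (suc n) {g} {g₁} {g₂} split = begin
  countBelow n (g 0 ∘ suc) + countPairs n _
    ≡⟨ cong₂ _+_ (countBelow-+ n (split 0 ∘ suc)) (countPairs-+ n (λ a b → split (suc a) (suc b))) ⟩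
  (countBelow n (g₁ 0 ∘ suc) + countBelow n (g₂ 0 ∘ suc)) + (countPairs n _ + countPairs n _)
    ≡⟨ interchange (countBelow n (g₁ 0 ∘ suc)) _ _ _ ⟩
  countPairs (suc n) g₁ + countPairs (suc n) g₂ ∎
  where open ≡-Reasoning

countPairs-cong : ∀ n {g g′ : ℕ → ℕ → Bool} → (∀ {a b} → a < b → g a b ≡ g′ a b) →
  countPairs n g ≡ countPairs n g′
countPairs-cong zero    g≗g′ = refl
countPairs-cong (suc n) g≗g′ =
  cong₂ _+_ (countBelow-cong n (λ b → g≗g′ (s≤s z≤n))) (countPairs-cong n (g≗g′ ∘ s<s))

suc² : ∀ {n} → Fin n × Fin n → Fin (suc n) × Fin (suc n)
suc² (x , y) = suc x , suc y

pairs : ∀ n → List (Fin n × Fin n)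
pairs zero    = []
pairs (suc n) = tabulate (λ y → zero , suc y) ++ map suc² (pairs n)

pairs-ordered : ∀ {n x y} → (x , y) ∈ pairs n → toℕ x < toℕ y
pairs-ordered {suc n} xy∈ with ∈-++⁻ (tabulate (λ y → zero , suc y)) xy∈
... | inj₁ xy∈ˡ with ∈-tabulate⁻ xy∈ˡ
...   | _ , refl = z<s
pairs-ordered {suc n} xy∈ | inj₂ xy∈ʳ with ∈-map⁻ suc² xy∈ʳ
...   | _ , xy∈′ , refl = s<s (pairs-ordered xy∈′)

pairs-complete : ∀ {n} {x y : Fin n} → toℕ x < toℕ y → (x , y) ∈ pairs n
pairs-complete {suc n} {zero}  {suc y} _         = ∈-++⁺ˡ (∈-tabulate⁺ y)
pairs-complete {suc n} {suc x} {suc y} (s<s x<y) =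
  ∈-++⁺ʳ (tabulate (λ y → zero , suc y)) (∈-map⁺ suc² (pairs-complete x<y))

pairs-unique : ∀ n → Unique (pairs n)
pairs-unique zero    = []
pairs-unique (suc n) = Unique.++⁺
  (Unique.tabulate⁺ λ { refl → refl })
  (Unique.map⁺ (λ { refl → refl }) (pairs-unique n))
  λ (xy∈ˡ , xy∈ʳ) → zero≢suc (∈-tabulate⁻ xy∈ˡ) (∈-map⁻ suc² xy∈ʳ)
  where
  zero≢suc : ∀ {p} → ∃ (λ y → p ≡ (zero , suc y)) → ∃ (λ q → q ∈ pairs n × p ≡ suc² q) → ⊥
  zero≢suc (_ , refl) (_ , _ , ())

count : ∀ {A : Set} → (A → Bool) → List A → ℕ
count f []       = 0
count f (x ∷ xs) = 𝟙 (f x) + count f xs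

length-filter-T? : ∀ {A : Set} (f : A → Bool) xs → length (filter (T? ∘ f) xs) ≡ count f xs
length-filter-T? f []       = refl
length-filter-T? f (x ∷ xs) with f x
... | true  = cong suc (length-filter-T? f xs)
... | false = length-filter-T? f xs

count-++ : ∀ {A : Set} (f : A → Bool) xs ys → count f (xs ++ ys) ≡ count f xs + count f ys
count-++ f []       ys = refl
count-++ f (x ∷ xs) ys = trans (cong (𝟙 (f x) +_) (count-++ f xs ys)) (sym (+-assoc (𝟙 (f x)) _ _))

count-map : ∀ {A B : Set} (f : B → Bool) (h : A → B) xs → count f (map h xs) ≡ count (f ∘ h) xs
count-map f h []       = refl
count-map f h (x ∷ xs) = cong (𝟙 (f (h x)) +_) (count-map f h xs)

count-tabulate : ∀ {A : Set} {n} (f : A → Bool) (h : Fin n → A) (F : ℕ → Bool) →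
  f ∘ h ≗ F ∘ toℕ → count f (tabulate h) ≡ countBelow n F
count-tabulate {n = zero}  f h F f∘h≗F = refl
count-tabulate {n = suc n} f h F f∘h≗F =
  cong₂ _+_ (cong 𝟙 (f∘h≗F zero)) (count-tabulate f (h ∘ suc) (F ∘ suc) (f∘h≗F ∘ suc))

count-pairs : ∀ n (g : ℕ → ℕ → Bool) → count (λ (x , y) → g (toℕ x) (toℕ y)) (pairs n) ≡ countPairs n g
count-pairs zero    g = refl
count-pairs (suc n) g = begin
  count g′ (tabulate (λ y → zero , suc y) ++ map suc² (pairs n))
    ≡⟨ count-++ g′ (tabulate (λ y → zero , suc y)) (map suc² (pairs n)) ⟩
  count g′ (tabulate (λ y → zero , suc y)) + count g′ (map suc² (pairs n))
    ≡⟨ cong₂ _+_ (count-tabulate g′ _ (g 0 ∘ suc) (λ _ → refl)) (count-map g′ suc² (pairs n)) ⟩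
  countBelow n (g 0 ∘ suc) + count (g′ ∘ suc²) (pairs n)
    ≡⟨ cong (countBelow n (g 0 ∘ suc) +_) (count-pairs n (λ a b → g (suc a) (suc b))) ⟩
  countPairs (suc n) g ∎
  where
  open ≡-Reasoning
  g′ : Fin (suc n) × Fin (suc n) → Bool
  g′ (x , y) = g (toℕ x) (toℕ y)

edgeCount : ∀ {n} (G : Graph n) (g : ℕ → ℕ → Bool) →
  (∀ {x y} → toℕ x < toℕ y → G x y ⇔ T (g (toℕ x) (toℕ y))) →
  EdgeCount G (countPairs n g)
edgeCount {n} G g G⇔g =
  edges , All.tabulate isEdge , Unique.filter⁺ P? (pairs-unique n) , complete , size
  where
  g′ : Fin n × Fin n → Bool
  g′ (x , y) = g (toℕ x) (toℕ y)
  P? = T? ∘ g′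
  edges = filter P? (pairs n)
  isEdge : ∀ {e} → e ∈ edges → IsEdge G e
  isEdge e∈ = let e∈pairs , ge = ∈-filter⁻ P? e∈
                  x<y = pairs-ordered e∈pairs
              in x<y , Equivalence.from (G⇔g x<y) ge
  complete : ∀ x y → IsEdge G (x , y) → (x , y) ∈ edges
  complete x y (x<y , Gxy) = ∈-filter⁺ P? (pairs-complete x<y) (Equivalence.to (G⇔g x<y) Gxy)
  size : length edges ≡ countPairs n g
  size = trans (length-filter-T? g′ (pairs n)) (count-pairs n g)

data Walkℕ (R : ℕ → ℕ → Set) : ℕ → ℕ → ℕ → Set where
  here : ∀ {a} → Walkℕ R 0 a a
  step : ∀ {l a b c} → R a b → Walkℕ R l b c → Walkℕ R (suc l) a c

_++ʷ_ : ∀ {R l₁ l₂ a b c} → Walkℕ R l₁ a b → Walkℕ R l₂ b c → Walkℕ R (l₁ + l₂) a c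
here     ++ʷ w′ = w′
step e w ++ʷ w′ = step e (w ++ʷ w′)

Walkℕ⇒Walk : ∀ {n} {R : ℕ → ℕ → Set} → (∀ {a b} → R a b → b < n) →
  ∀ {l a b} {x y : Fin n} → Walkℕ R l a b → toℕ x ≡ a → toℕ y ≡ b →
  Walk (λ x y → R (toℕ x) (toℕ y)) l x y
Walkℕ⇒Walk bound here x≡a y≡a = subst (Walk _ 0 _) (toℕ-injective (trans x≡a (sym y≡a))) here
Walkℕ⇒Walk {R = R} bound {x = x} (step e w) refl y≡c =
  step (subst (R (toℕ x)) (sym (toℕ-fromℕ< (bound e))) e) (Walkℕ⇒Walk bound w (toℕ-fromℕ< (bound e)) y≡c)

-- The distance from vertex 0 in Q_k.
level : ℕ → ℕ
level 0                   = 0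
level 1                   = 1
level 2                   = 1
level (suc (suc (suc a))) = 2 + level a

level-*3 : ∀ i → level (i * 3) ≡ i * 2
level-*3 zero    = refl
level-*3 (suc i) = cong (2 +_) (level-*3 i)

level-*3+ : ∀ i r → level (i * 3 + r) ≡ i * 2 + level r
level-*3+ zero    r = refl
level-*3+ (suc i) r = cong (2 +_) (level-*3+ i r)

level-3*+ : ∀ i r → level (3 * i + r) ≡ level r + i * 2
level-3*+ i r = begin
  level (3 * i + r) ≡⟨ cong (λ j → level (j + r)) (*-comm 3 i) ⟩
  level (i * 3 + r) ≡⟨ level-*3+ i r ⟩
  i * 2 + level r   ≡⟨ +-comm (i * 2) (level r) ⟩
  level r + i * 2   ∎
  where open ≡-Reasoning

square-level : ∀ i {a b} → SquareEdge i a b → level b ≡ suc (level a)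
square-level i (inj₁ (refl , refl))
  rewrite level-3*+ i 1 | *-comm 3 i | level-*3 i = refl
square-level i (inj₂ (inj₁ (refl , refl)))
  rewrite level-3*+ i 2 | *-comm 3 i | level-*3 i = refl
square-level i (inj₂ (inj₂ (inj₁ (refl , refl))))
  rewrite level-3*+ i 3 | level-3*+ i 1 = refl
square-level i (inj₂ (inj₂ (inj₂ (refl , refl))))
  rewrite level-3*+ i 3 | level-3*+ i 2 = refl

square-vertices-≤ : ∀ i {a b} → SquareEdge i a b → a ≤ 3 * i + 3 × b ≤ 3 * i + 3
square-vertices-≤ i (inj₁ (refl , refl))                = m≤m+n (3 * i) 3 , +-monoʳ-≤ (3 * i) (s≤s z≤n)
square-vertices-≤ i (inj₂ (inj₁ (refl , refl)))         = m≤m+n (3 * i) 3 , +-monoʳ-≤ (3 * i) (s≤s (s≤s z≤n))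
square-vertices-≤ i (inj₂ (inj₂ (inj₁ (refl , refl))))  = +-monoʳ-≤ (3 * i) (s≤s z≤n) , ≤-refl
square-vertices-≤ i (inj₂ (inj₂ (inj₂ (refl , refl))))  = +-monoʳ-≤ (3 * i) (s≤s (s≤s z≤n)) , ≤-refl

QAdj-≤ : ∀ {k a b} → QAdj k a b → b ≤ 3 * k
QAdj-≤ {k} (i , i<k , e) = ≤-trans (endpoint e) (begin
  3 * i + 3 ≡⟨ +-comm (3 * i) 3 ⟩
  3 + 3 * i ≡⟨ *-suc 3 i ⟨
  3 * suc i ≤⟨ *-monoʳ-≤ 3 i<k ⟩
  3 * k     ∎)
  where
  open ≤-Reasoning
  endpoint : ∀ {a b} → SquareEdge i a b ⊎ SquareEdge i b a → b ≤ 3 * i + 3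
  endpoint (inj₁ e) = proj₂ (square-vertices-≤ i e)
  endpoint (inj₂ e) = proj₁ (square-vertices-≤ i e)

level-adjacent : ∀ {k a b} → QAdj k a b → level b ≤ suc (level a)
level-adjacent (i , _ , inj₁ e) = ≤-reflexive (square-level i e)
level-adjacent (i , _ , inj₂ e) = m≤n⇒m≤1+n (≤-trans (n≤1+n _) (≤-reflexive (sym (square-level i e))))

level-walk : ∀ {k l x y} → Walk (Q k) l x y → level (toℕ y) ≤ level (toℕ x) + l
level-walk {x = x} here = ≤-reflexive (sym (+-identityʳ (level (toℕ x))))
level-walk {l = suc l} {x = x} {y = y} (step {y = z} xz w) = begin
  level (toℕ y)       ≤⟨ level-walk w ⟩
  level (toℕ z) + l   ≤⟨ +-monoˡ-≤ l (level-adjacent xz) ⟩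
  suc (level (toℕ x)) + l ≡⟨ +-suc (level (toℕ x)) l ⟨
  level (toℕ x) + suc l ∎
  where open ≤-Reasoning

level-suc : ∀ a → level a ≤ level (suc a)
level-suc 0                   = z≤n
level-suc 1                   = ≤-refl
level-suc 2                   = s≤s z≤n
level-suc (suc (suc (suc a))) = s≤s (s≤s (level-suc a))

level-mono : ∀ {a b} → a ≤ b → level a ≤ level b
level-mono a≤b = go (≤⇒≤′ a≤b)
  where
  go : ∀ {a b} → a ≤′ b → level a ≤ level b
  go ≤′-refl          = ≤-refl
  go (≤′-step {b} a≤b) = ≤-trans (go a≤b) (level-suc b)

QWalk : ℕ → ℕ → ℕ → ℕ → Set
QWalk k = Walkℕ (QAdj k)

record Ascent (k a b : ℕ) : Set where
  constructor ascent
  field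
    steps  : ℕ
    walk   : QWalk k steps a b
    climbs : steps + level a ≡ level b

ascent-refl : ∀ {k a} → Ascent k a a
ascent-refl = ascent 0 here refl

infixl 5 _▸_
_▸_ : ∀ {k a b c} → Ascent k a b → Ascent k b c → Ascent k a c
_▸_ {a = a} {b} {c} (ascent l₁ w₁ c₁) (ascent l₂ w₂ c₂) = ascent (l₁ + l₂) (w₁ ++ʷ w₂) (begin
  (l₁ + l₂) + level a ≡⟨ cong (_+ level a) (+-comm l₁ l₂) ⟩
  (l₂ + l₁) + level a ≡⟨ +-assoc l₂ l₁ (level a) ⟩
  l₂ + (l₁ + level a) ≡⟨ cong (l₂ +_) c₁ ⟩
  l₂ + level b        ≡⟨ c₂ ⟩
  level c             ∎)
  where open ≡-Reasoning

square-ascent : ∀ {k i a b} → i < k → SquareEdge i a b → Ascent k a b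
square-ascent {i = i} i<k e = ascent 1 (step (i , i<k , inj₁ e) here) (sym (square-level i e))

data Position : ℕ → Set where
  hub   : ∀ i → Position (i * 3)
  left  : ∀ i → Position (1 + i * 3)
  right : ∀ i → Position (2 + i * 3)

position : ∀ a → Position a
position 0 = hub 0
position 1 = left 0
position 2 = right 0
position (suc (suc (suc a))) with position a
... | hub i   = hub (suc i)
... | left i  = left (suc i)
... | right i = right (suc i)

r+i*3≡3*i+r : ∀ i r → r + i * 3 ≡ 3 * i + r
r+i*3≡3*i+r i r = trans (cong (r +_) (*-comm i 3)) (+-comm r (3 * i))

hub-left : ∀ i → SquareEdge i (i * 3) (1 + i * 3)
hub-left i = inj₁ (*-comm i 3 , r+i*3≡3*i+r i 1)

hub-right : ∀ i → SquareEdge i (i * 3) (2 + i * 3)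
hub-right i = inj₂ (inj₁ (*-comm i 3 , r+i*3≡3*i+r i 2))

left-hub : ∀ i → SquareEdge i (1 + i * 3) (suc i * 3)
left-hub i = inj₂ (inj₂ (inj₁ (r+i*3≡3*i+r i 1 , r+i*3≡3*i+r i 3)))

right-hub : ∀ i → SquareEdge i (2 + i * 3) (suc i * 3)
right-hub i = inj₂ (inj₂ (inj₂ (r+i*3≡3*i+r i 2 , r+i*3≡3*i+r i 3)))

hub-≤ : ∀ i {k} → i * 3 ≤ 3 * k → i ≤ k
hub-≤ i {k} i3≤3k = *-cancelʳ-≤ i k 3 (subst (i * 3 ≤_) (*-comm 3 k) i3≤3k)

non-hub-< : ∀ i {k} → 1 + i * 3 ≤ 3 * k → i < k
non-hub-< i {k} i3<3k = *-cancelʳ-< 3 i k (subst (i * 3 <_) (*-comm 3 k) i3<3k)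

hub-below : ∀ i j r → r < 3 → i * 3 ≤ r + j * 3 → i ≤ j
hub-below i j r r<3 i3≤ = ≤-pred (*-cancelʳ-< 3 i (suc j) (≤-<-trans i3≤ (+-monoˡ-< (j * 3) r<3)))

ascent-hubs : ∀ {k i j} → i ≤′ j → j ≤ k → Ascent k (i * 3) (j * 3)
ascent-hubs ≤′-refl         _   = ascent-refl
ascent-hubs (≤′-step {j} i≤j) j<k =
  ascent-hubs i≤j (<⇒≤ j<k) ▸ square-ascent j<k (hub-left j) ▸ square-ascent j<k (left-hub j)

ascent-from-hub : ∀ {k} i {b} → i * 3 ≤ b → b ≤ 3 * k → Ascent k (i * 3) b
ascent-from-hub {k} i {b} i3≤b b≤3k with position b
... | hub j   = ascent-hubs (≤⇒≤′ (hub-below i j 0 (s≤s z≤n) i3≤b)) (hub-≤ j b≤3k)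
... | left j  = ascent-hubs (≤⇒≤′ (hub-below i j 1 (s≤s (s≤s z≤n)) i3≤b)) (<⇒≤ j<k) ▸ square-ascent j<k (hub-left j)
  where j<k = non-hub-< j b≤3k
... | right j = ascent-hubs (≤⇒≤′ (hub-below i j 2 ≤-refl i3≤b)) (<⇒≤ j<k) ▸ square-ascent j<k (hub-right j)
  where j<k = non-hub-< j (≤-trans (n≤1+n _) b≤3k)

-- The two middle vertices 1 + i * 3 < 2 + i * 3 of a square share a level; they
-- are joined through the hub i * 3.
ascent-or-twins : ∀ {k a b} → a < b → b ≤ 3 * k → Ascent k a b ⊎ QWalk k 2 a b
ascent-or-twins {k} {a} {b} a<b b≤3k with position a
... | hub i   = inj₁ (ascent-from-hub i (<⇒≤ a<b) b≤3k)
... | right i = inj₁ (square-ascent i<k (right-hub i) ▸ ascent-from-hub (suc i) a<b b≤3k)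
  where i<k = hub-≤ (suc i) (≤-trans a<b b≤3k)
... | left i with m≤n⇒m<n∨m≡n a<b
...   | inj₁ a+1<b = inj₁ (square-ascent i<k (left-hub i) ▸ ascent-from-hub (suc i) a+1<b b≤3k)
  where i<k = hub-≤ (suc i) (≤-trans a+1<b b≤3k)
...   | inj₂ refl  = inj₂ (step (i , i<k , inj₂ (hub-left i)) (step (i , i<k , inj₁ (hub-right i)) here))
  where i<k = non-hub-< i (≤-trans (n≤1+n _) b≤3k)

levelGap≤ : ℕ → ℕ → ℕ → Bool
levelGap≤ m a b = level b ≤ᵇ level a + m

pairsWithin : ℕ → ℕ → ℕ
pairsWithin k m = countPairs (suc (k * 3)) (levelGap≤ m)

power-Q⇔ : ∀ {k m} → 2 ≤ m → ∀ {x y : Fin (suc (3 * k))} → toℕ x < toℕ y →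
  power (Q k) m x y ⇔ T (levelGap≤ m (toℕ x) (toℕ y))
power-Q⇔ {k} {m} 2≤m {x} {y} x<y = mk⇔ to from
  where
  to : power (Q k) m x y → T (levelGap≤ m (toℕ x) (toℕ y))
  to (_ , l , l≤m , w) = ≤⇒≤ᵇ (≤-trans (level-walk w) (+-monoʳ-≤ (level (toℕ x)) l≤m))
  lift : ∀ {l} → QWalk k l (toℕ x) (toℕ y) → Walk (Q k) l x y
  lift w = Walkℕ⇒Walk (s≤s ∘ QAdj-≤) w refl refl
  x≢y : x ≢ y
  x≢y x≡y = <⇒≢ x<y (cong toℕ x≡y)
  from : T (levelGap≤ m (toℕ x) (toℕ y)) → power (Q k) m x y
  from near with ascent-or-twins x<y (≤-pred (toℕ<n y))
  ... | inj₁ (ascent l w climbs) = x≢y , l , l≤m , lift w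
    where
    l≤m : l ≤ m
    l≤m = +-cancelʳ-≤ (level (toℕ x)) l m (begin
      l + level (toℕ x) ≡⟨ climbs ⟩
      level (toℕ y)     ≤⟨ ≤ᵇ⇒≤ _ _ near ⟩
      level (toℕ x) + m ≡⟨ +-comm (level (toℕ x)) m ⟩
      m + level (toℕ x) ∎)
      where open ≤-Reasoning
  ... | inj₂ w = x≢y , 2 , 2≤m , lift w

edgeCount-power-Q : ∀ {k m} → 2 ≤ m → EdgeCount (power (Q k) m) (pairsWithin k m)
edgeCount-power-Q {k} {m} 2≤m =
  subst (EdgeCount (power (Q k) m)) (cong (λ n → countPairs (suc n) (levelGap≤ m)) (*-comm 3 k))
    (edgeCount (power (Q k) m) (levelGap≤ m) (power-Q⇔ 2≤m))

noPerfectMatching-power-Q : ∀ {k m} → 2 ∣ k → ¬ PerfectMatching (power (Q k) m)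
noPerfectMatching-power-Q {k} 2∣k M = contradiction (∣1⇒≡1 2∣1) λ ()
  where
  2∣1 : 2 ∣ 1
  2∣1 = ∣m+n∣m⇒∣n (subst (2 ∣_) (+-comm 1 (3 * k)) (perfectMatching⇒even M)) (∣n⇒∣m*n 3 2∣k)

antiForcingNumber-power-Q : ∀ {k m} → 2 ∣ k → 2 ≤ m → AntiForcingNumber (power (Q k) m) (pairsWithin k m)
antiForcingNumber-power-Q 2∣k 2≤m = inj₂ (noPerfectMatching-power-Q 2∣k , edgeCount-power-Q 2≤m)

𝟙-≤ᵇ-suc : ∀ a b → 𝟙 (a ≤ᵇ suc b) ≡ 𝟙 (a ≤ᵇ b) + 𝟙 (a ≡ᵇ suc b)
𝟙-≤ᵇ-suc zero          b       = refl
𝟙-≤ᵇ-suc (suc zero)    zero    = refl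
𝟙-≤ᵇ-suc (suc (suc a)) zero    = refl
𝟙-≤ᵇ-suc (suc zero)    (suc b) = refl
𝟙-≤ᵇ-suc (suc (suc a)) (suc b) = 𝟙-≤ᵇ-suc (suc a) b

≥⇒≤ᵇ≡≡ᵇ : ∀ {a b} → b ≤ a → (a ≤ᵇ b) ≡ (a ≡ᵇ b)
≥⇒≤ᵇ≡≡ᵇ {zero}  z≤n = refl
≥⇒≤ᵇ≡≡ᵇ {suc a} z≤n = refl
≥⇒≤ᵇ≡≡ᵇ {suc zero} (s≤s z≤n) = refl
≥⇒≤ᵇ≡≡ᵇ {suc (suc a)} (s≤s b≤a) = ≥⇒≤ᵇ≡≡ᵇ b≤a

∸-split : ∀ k t → k ∸ t ≡ 𝟙 (t <ᵇ k) + (k ∸ suc t)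
∸-split zero    zero    = refl
∸-split zero    (suc t) = refl
∸-split (suc k) zero    = refl
∸-split (suc k) (suc t) = ∸-split k t

levelGap≡ : ℕ → ℕ → ℕ → Bool
levelGap≡ d a b = level b ≡ᵇ level a + d

pairsAtGap : ℕ → ℕ → ℕ
pairsAtGap k d = countPairs (suc (k * 3)) (levelGap≡ d)

levelSize : ℕ → ℕ → ℕ
levelSize k c = countBelow (suc (k * 3)) (λ b → level b ≡ᵇ c)

pairsWithin-zero : ∀ k → pairsWithin k 0 ≡ pairsAtGap k 0
pairsWithin-zero k = countPairs-cong (suc (k * 3)) λ {a} {b} a<b →
  subst (λ n → (level b ≤ᵇ n) ≡ (level b ≡ᵇ n)) (sym (+-identityʳ (level a)))
    (≥⇒≤ᵇ≡≡ᵇ (level-mono (<⇒≤ a<b)))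

pairsWithin-suc : ∀ k m → pairsWithin k (suc m) ≡ pairsWithin k m + pairsAtGap k (suc m)
pairsWithin-suc k m = countPairs-+ (suc (k * 3)) {g₁ = levelGap≤ m} {g₂ = levelGap≡ (suc m)} λ a b →
  subst (λ n → 𝟙 (level b ≤ᵇ n) ≡ 𝟙 (level b ≤ᵇ level a + m) + 𝟙 (level b ≡ᵇ n))
    (sym (+-suc (level a) m)) (𝟙-≤ᵇ-suc (level b) (level a + m))

-- For Q_(k+1), countPairs and countBelow unfold definitionally through the vertices
-- 0, 1, 2 of the first square; the remaining vertices 3 + b have level 2 + level b,
-- so what is left are the counts for Q_k.  This drives the recursive clauses and
-- the ≡⟨⟩ steps below.
levelSize-even : ∀ k t → levelSize k (t * 2) ≡ 𝟙 (t <ᵇ suc k)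
levelSize-even zero    zero    = refl
levelSize-even zero    (suc t) = refl
levelSize-even (suc k) zero    = cong suc (countBelow-false (suc (k * 3)))
levelSize-even (suc k) (suc t) = levelSize-even k t

levelSize-odd : ∀ k t → levelSize k (suc (t * 2)) ≡ 2 * 𝟙 (t <ᵇ k)
levelSize-odd zero    zero    = refl
levelSize-odd zero    (suc t) = refl
levelSize-odd (suc k) zero    = cong (2 +_) (countBelow-false (suc (k * 3)))
levelSize-odd (suc k) (suc t) = levelSize-odd k t

pairsAtGap-zero : ∀ k → pairsAtGap k 0 ≡ k
pairsAtGap-zero zero    = refl
pairsAtGap-zero (suc k) = begin
  pairsAtGap (suc k) 0                  ≡⟨⟩
  Z + (suc Z + (Z + pairsAtGap k 0))    ≡⟨ cong (λ z → z + (suc z + (z + pairsAtGap k 0))) (countBelow-false (suc (k * 3))) ⟩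
  suc (pairsAtGap k 0)                  ≡⟨ cong suc (pairsAtGap-zero k) ⟩
  suc k                                 ∎
  where
  open ≡-Reasoning
  Z = countBelow (suc (k * 3)) (λ _ → false)

pairsAtGap-odd : ∀ k t → pairsAtGap k (suc (t * 2)) ≡ 4 * (k ∸ t)
pairsAtGap-odd zero    t       = cong (4 *_) (sym (0∸n≡0 t))
pairsAtGap-odd (suc k) zero    = begin
  pairsAtGap (suc k) 1                              ≡⟨⟩
  2 + Z + (levelSize k 0 + (levelSize k 0 + pairsAtGap k 1))
    ≡⟨ cong₃ (λ z h d → 2 + z + (h + (h + d))) (countBelow-false (suc (k * 3))) (levelSize-even k 0) (pairsAtGap-odd k 0) ⟩
  2 + 0 + (1 + (1 + 4 * k))                         ≡⟨ arith k ⟩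
  4 * suc k                                         ∎
  where
  open ≡-Reasoning
  Z = countBelow (suc (k * 3)) (λ _ → false)
  arith : ∀ k → 2 + 0 + (1 + (1 + 4 * k)) ≡ 4 * suc k
  arith = solve-∀
pairsAtGap-odd (suc k) (suc t) = begin
  pairsAtGap (suc k) (suc (suc t * 2))              ≡⟨⟩
  levelSize k (suc (t * 2)) + (levelSize k (suc t * 2) + (levelSize k (suc t * 2) + pairsAtGap k (suc (suc t * 2))))
    ≡⟨ cong₃ (λ h₁ h₂ d → h₁ + (h₂ + (h₂ + d))) (levelSize-odd k t) (levelSize-even k (suc t)) (pairsAtGap-odd k (suc t)) ⟩
  2 * 𝟙 (t <ᵇ k) + (𝟙 (t <ᵇ k) + (𝟙 (t <ᵇ k) + 4 * (k ∸ suc t)))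
    ≡⟨ arith (𝟙 (t <ᵇ k)) (k ∸ suc t) ⟩
  4 * (𝟙 (t <ᵇ k) + (k ∸ suc t))                    ≡⟨ cong (4 *_) (∸-split k t) ⟨
  4 * (k ∸ t)                                       ∎
  where
  open ≡-Reasoning
  arith : ∀ b c → 2 * b + (b + (b + 4 * c)) ≡ 4 * (b + c)
  arith = solve-∀

pairsAtGap-even : ∀ k t → pairsAtGap k (suc t * 2) ≡ (k ∸ t) + 4 * (k ∸ suc t)
pairsAtGap-even zero    t = cong₂ (λ a b → a + 4 * b) (sym (0∸n≡0 t)) (sym (0∸n≡0 (suc t)))
pairsAtGap-even (suc k) t = begin
  pairsAtGap (suc k) (suc t * 2)                    ≡⟨⟩
  levelSize k (t * 2) + (levelSize k (suc (t * 2)) + (levelSize k (suc (t * 2)) + pairsAtGap k (suc t * 2)))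
    ≡⟨ cong₃ (λ h₀ h₁ d → h₀ + (h₁ + (h₁ + d))) (levelSize-even k t) (levelSize-odd k t) (pairsAtGap-even k t) ⟩
  a + (2 * b + (2 * b + ((k ∸ t) + 4 * c)))         ≡⟨ cong (λ x → a + (2 * b + (2 * b + (x + 4 * c)))) (∸-split k t) ⟩
  a + (2 * b + (2 * b + ((b + c) + 4 * c)))         ≡⟨ arith a b c ⟩
  (a + (b + c)) + 4 * (b + c)                       ≡⟨ cong (λ x → (a + x) + 4 * x) (∸-split k t) ⟨
  (a + (k ∸ t)) + 4 * (k ∸ t)                       ≡⟨ cong (_+ 4 * (k ∸ t)) (∸-split (suc k) t) ⟨
  (suc k ∸ t) + 4 * (k ∸ t)                         ∎
  where
  open ≡-Reasoning
  a = 𝟙 (t <ᵇ suc k)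
  b = 𝟙 (t <ᵇ k)
  c = k ∸ suc t
  arith : ∀ a b c → a + (2 * b + (2 * b + ((b + c) + 4 * c))) ≡ (a + (b + c)) + 4 * (b + c)
  arith = solve-∀

data Parity : ℕ → Set where
  even : ∀ t → Parity (t * 2)
  odd  : ∀ t → Parity (suc (t * 2))

parity : ∀ m → Parity m
parity zero          = even 0
parity (suc zero)    = odd 0
parity (suc (suc m)) with parity m
... | even t = even (suc t)
... | odd t  = odd (suc t)

⌊t*2/2⌋≡t : ∀ t → ⌊ t * 2 /2⌋ ≡ t
⌊t*2/2⌋≡t zero    = refl
⌊t*2/2⌋≡t (suc t) = cong suc (⌊t*2/2⌋≡t t)

⌊1+t*2/2⌋≡t : ∀ t → ⌊ suc (t * 2) /2⌋ ≡ t
⌊1+t*2/2⌋≡t zero    = refl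
⌊1+t*2/2⌋≡t (suc t) = cong suc (⌊1+t*2/2⌋≡t t)

pairsWithin-even-step : ∀ k m → m % 2 ≡ 0 → 2 ≤ m → m ≤ 2 * k →
  pairsWithin k m ≡ pairsWithin k (m ∸ 1) + 5 * (k ∸ ⌊ m /2⌋) + 1
pairsWithin-even-step k m m-even 2≤m m≤2k with parity m
... | odd t        = contradiction (trans (sym ([m+kn]%n≡m%n 1 t 2)) m-even) λ ()
... | even zero    = contradiction 2≤m λ ()
... | even (suc t) = begin
  pairsWithin k (suc t * 2)                    ≡⟨ pairsWithin-suc k (suc (t * 2)) ⟩
  P + pairsAtGap k (suc t * 2)                 ≡⟨ cong (P +_) (pairsAtGap-even k t) ⟩
  P + ((k ∸ t) + 4 * c)                        ≡⟨ cong (λ x → P + (x + 4 * c)) (∸-split k t) ⟩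
  P + ((𝟙 (t <ᵇ k) + c) + 4 * c)               ≡⟨ cong (λ b → P + ((b + c) + 4 * c)) t<ᵇk ⟩
  P + ((1 + c) + 4 * c)                        ≡⟨ arith P c ⟩
  P + 5 * c + 1                                ≡⟨ cong (λ s → P + 5 * (k ∸ s) + 1) (⌊t*2/2⌋≡t (suc t)) ⟨
  P + 5 * (k ∸ ⌊ suc t * 2 /2⌋) + 1            ∎
  where
  open ≡-Reasoning
  P = pairsWithin k (suc (t * 2))
  c = k ∸ suc t
  t<ᵇk : 𝟙 (t <ᵇ k) ≡ 1
  t<ᵇk = cong 𝟙 (Equivalence.to T-≡ (<⇒<ᵇ (*-cancelʳ-≤ (suc t) k 2 (subst (suc t * 2 ≤_) (*-comm 2 k) m≤2k))))
  arith : ∀ p c → p + ((1 + c) + 4 * c) ≡ p + 5 * c + 1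
  arith = solve-∀

pairsWithin-odd-step : ∀ k m → m % 2 ≡ 1 → pairsWithin k m ≡ pairsWithin k (m ∸ 1) + 4 * (k ∸ ⌊ m /2⌋)
pairsWithin-odd-step k m m-odd with parity m
... | even t = contradiction (trans (sym (m*n%n≡0 t 2)) m-odd) λ ()
... | odd t  = begin
  pairsWithin k (suc (t * 2))                     ≡⟨ pairsWithin-suc k (t * 2) ⟩
  pairsWithin k (t * 2) + pairsAtGap k (suc (t * 2)) ≡⟨ cong (pairsWithin k (t * 2) +_) (pairsAtGap-odd k t) ⟩
  pairsWithin k (t * 2) + 4 * (k ∸ t)             ≡⟨ cong (λ s → pairsWithin k (t * 2) + 4 * (k ∸ s)) (⌊1+t*2/2⌋≡t t) ⟨
  pairsWithin k (t * 2) + 4 * (k ∸ ⌊ suc (t * 2) /2⌋) ∎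
  where open ≡-Reasoning

pairsWithin-two : ∀ {k} → 1 ≤ k → pairsWithin k 2 ≡ 10 * k ∸ 4
pairsWithin-two {suc k} _ = begin
  pairsWithin (suc k) 2                                          ≡⟨ pairsWithin-suc (suc k) 1 ⟩
  pairsWithin (suc k) 1 + pairsAtGap (suc k) 2                   ≡⟨ cong (_+ pairsAtGap (suc k) 2) (pairsWithin-suc (suc k) 0) ⟩
  pairsWithin (suc k) 0 + pairsAtGap (suc k) 1 + pairsAtGap (suc k) 2
    ≡⟨ cong₃ (λ x y z → x + y + z) (trans (pairsWithin-zero (suc k)) (pairsAtGap-zero (suc k))) (pairsAtGap-odd (suc k) 0) (pairsAtGap-even (suc k) 0) ⟩
  suc k + 4 * suc k + (suc k + 4 * k)                            ≡⟨ arith k ⟩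
  6 + 10 * k                                                     ≡⟨ cong (_∸ 4) (*-suc 10 k) ⟨
  10 * suc k ∸ 4                                                 ∎
  where
  open ≡-Reasoning
  arith : ∀ k → suc k + 4 * suc k + (suc k + 4 * k) ≡ 6 + 10 * k
  arith = solve-∀

theorem2p8 : (k : ℕ) → 1 ≤ k → k % 2 ≡ 0 →
    (AntiForcingNumber (power (Q k) 2) (10 * k ∸ 4)
     × (∀ m → m % 2 ≡ 0 → 4 ≤ m → m ≤ 2 * k →
          Σ ℕ λ a → AntiForcingNumber (power (Q k) (m ∸ 1)) a
            × AntiForcingNumber (power (Q k) m) (a + 5 * (k ∸ ⌊ m /2⌋) + 1)))
    × (∀ m → m % 2 ≡ 1 → 3 ≤ m → m ≤ 2 * k + 1 →
          Σ ℕ λ a → AntiForcingNumber (power (Q k) (m ∸ 1)) a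
            × AntiForcingNumber (power (Q k) m) (a + 4 * (k ∸ ⌊ m /2⌋)))
theorem2p8 k 1≤k k-even =
  ( subst (AntiForcingNumber (power (Q k) 2)) (pairsWithin-two 1≤k) (af 2 ≤-refl)
  , λ m m-even 4≤m m≤2k →
      pairsWithin k (m ∸ 1) , af (m ∸ 1) (∸-monoˡ-≤ 1 (≤-trans (n≤1+n 3) 4≤m)) ,
      subst (AntiForcingNumber (power (Q k) m))
        (pairsWithin-even-step k m m-even (≤-trans 2≤4 4≤m) m≤2k) (af m (≤-trans 2≤4 4≤m)))
  , λ m m-odd 3≤m _ →
      pairsWithin k (m ∸ 1) , af (m ∸ 1) (∸-monoˡ-≤ 1 3≤m) ,
      subst (AntiForcingNumber (power (Q k) m))
        (pairsWithin-odd-step k m m-odd) (af m (≤-trans (n≤1+n 2) 3≤m))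
  where
  af : ∀ m → 2 ≤ m → AntiForcingNumber (power (Q k) m) (pairsWithin k m)
  af m = antiForcingNumber-power-Q (m%n≡0⇒n∣m k 2 k-even)
  2≤4 : 2 ≤ 4
  2≤4 = s≤s (s≤s z≤n)
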